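{- For every non-negative integer $t$ there is a constant $c_t$ such that every graph $G$ with twin-width at most $t$ satisfies $\alpha_2^*(G)\leqslant c_t\,\alpha_2(G)$, where $\alpha_2(G)$ is the maximum size of a set of vertices of $G$ no two of which are at distance at most $2$, and $\alpha_2^*(G)$ is the optimum value of the linear program: maximize $\sum_{x\in V(G)}w(x)$ subject to $\sum_{y\in N[x]}w(y)\leqslant 1$ for all $x\in V(G)$ and $0\leqslant w(x)\leqslant 1$ for all $x$.
   Context: $N[x]$ is the closed neighborhood of $x$. A trigraph has a vertex set, black edges and disjoint red edges; contracting two (not necessarily adjacent) vertices $u,v$ replaces them by a new vertex $z$ with, for each other vertex $x$: $zx$ black if $ux,vx$ both black, red if $x$ is adjacent (black or red) to at least one of $u,v$ but not both via black edges, absent otherwise. A $d$-sequence of an $n$-vertex graph $G$ is a sequence of trigraphs $G=G_n,\ldots,G_1$ whose red graphs have maximum degree at most $d$, with $G_1$ a single vertex and each obtained from the previous by one contraction; the twin-width is the least such $d$.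
   Formalization: The weights w(x) of the linear program range over rational rather than real numbers, and the bound is stated for every rational feasible w; since the program has rational data, its real optimum is attained at a rational point. -}

module Defs where

open import Data.Nat as ℕ using (ℕ; zero; suc)
open import Data.Bool using (Bool; true; false; if_then_else_; _∨_)
open import Data.Fin using (Fin; _≟_; punchIn)
open import Data.Fin.Subset using (Subset; _∈_; ∣_∣)
open import Data.List using (List; allFin; foldr; map; length; filter)
open import Data.Product using (Σ; ∃; _×_; _,_)
open import Data.Unit using (⊤)
open import Relation.Nullary using (¬_; does)
open import Relation.Binary.PropositionalEquality using (_≡_; _≢_)
open import Data.Integer using (+_)
open import Data.Rational as ℚ using (ℚ; 0ℚ; 1ℚ; _/_)

record Graph (n : ℕ) : Set where
  field
    adj    : Fin n → Fin n → Bool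
    sym    : ∀ x y → adj x y ≡ adj y x
    irrefl : ∀ x → adj x x ≡ false
open Graph public

data Colour : Set where
  none black red : Colour

Trigraph : ℕ → Set
Trigraph m = Fin m → Fin m → Colour

toTrigraph : ∀ {n} → Graph n → Trigraph n
toTrigraph G x y = if adj G x y then black else none

-- colour of zx when merging u,v into z, from the colours ux and vx
merge : Colour → Colour → Colour
merge black black = black
merge none  none  = none
merge _     _     = red

-- Contraction of two distinct vertices u,v of a trigraph on Fin (suc m):
-- v is deleted (the remaining vertices are renumbered by punchIn v), and
-- u plays the role of the new vertex z.
contract : ∀ {m} → Trigraph (suc m) → (u v : Fin (suc m)) → Trigraph m
contract T u v a b with punchIn v a | punchIn v b
... | a' | b' with does (a' ≟ u) | does (b' ≟ u)
... | true  | true  = none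
... | true  | false = merge (T u b') (T v b')
... | false | true  = merge (T u a') (T v a')
... | false | false = T a' b'

isRed : Colour → Bool
isRed red = true
isRed _   = false

redDegree : ∀ {m} → Trigraph m → Fin m → ℕ
redDegree {m} T a = length (filter (λ b → Data.Bool._≟_ (isRed (T a b)) true) (allFin m))
  where import Data.Bool

RedDegreeAtMost : ∀ {m} → ℕ → Trigraph m → Set
RedDegreeAtMost d T = ∀ a → redDegree T a ℕ.≤ d

data DSeq (d : ℕ) : (m : ℕ) → Trigraph (suc m) → Set where
  done : (T : Trigraph 1) → RedDegreeAtMost d T → DSeq d 0 T
  step : ∀ {m} (T : Trigraph (suc (suc m))) → RedDegreeAtMost d T →
         (u v : Fin (suc (suc m))) → u ≢ v →
         DSeq d m (contract T u v) → DSeq d (suc m) T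

-- twin-width at most t (the empty graph is taken to have twin-width 0)
TwinWidthAtMost : ∀ {n} → ℕ → Graph n → Set
TwinWidthAtMost {zero}  t G = ⊤
TwinWidthAtMost {suc m} t G = DSeq t m (toTrigraph G)

-- x and y are at distance at most 2 (x ≢ y)
Dist≤2 : ∀ {n} → Graph n → Fin n → Fin n → Set
Dist≤2 G x y = adj G x y ≡ true ⊎' ∃ λ z → adj G x z ≡ true × adj G z y ≡ true
  where
  open import Data.Sum renaming (_⊎_ to _⊎'_)

Independent₂ : ∀ {n} → Graph n → Subset n → Set
Independent₂ G S = ∀ x y → x ∈ S → y ∈ S → x ≢ y → ¬ Dist≤2 G x y

IsAlpha₂ : ∀ {n} → Graph n → ℕ → Set
IsAlpha₂ G k = (∃ λ S → Independent₂ G S × ∣ S ∣ ≡ k)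
             × (∀ S → Independent₂ G S → ∣ S ∣ ℕ.≤ k)

sumℚ : ∀ {n} → (Fin n → ℚ) → ℚ
sumℚ {n} f = foldr ℚ._+_ 0ℚ (map f (allFin n))

closedNbhdSum : ∀ {n} → Graph n → (Fin n → ℚ) → Fin n → ℚ
closedNbhdSum G w x = sumℚ (λ y → if does (y ≟ x) ∨ adj G x y then w y else 0ℚ)

Feasible : ∀ {n} → Graph n → (Fin n → ℚ) → Set
Feasible G w = ∀ x → (0ℚ ℚ.≤ w x) × (w x ℚ.≤ 1ℚ) × (closedNbhdSum G w x ℚ.≤ 1ℚ)

ℕtoℚ : ℕ → ℚ
ℕtoℚ k = + k / 1

{-# OPTIONS --safe #-}
-- Call a part of a contraction sequence heavy if its weight exceeds 1. At the
-- first moment a heavy part P appears, all parts weigh at most 2. A vertex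
-- joined to P by a black edge would see all of P, violating feasibility, so P
-- has only red neighbours, at most t of them. The closed neighbourhood of any
-- part Q weighs at most 2(t+1) + 1: Q and its red neighbours weigh at most
-- 2(t+1), and the black neighbours all lie in N[u] for any single u in Q. Hence
-- the ball of radius 2 around any vertex of P weighs at most (t+1)(2(t+1)+1).
-- Greedily picking a vertex of positive weight in P, then setting the weight of
-- its ball to zero and restarting from the original graph, builds the packing.
module Submission where

open import Defs
open import Data.Nat using (ℕ; _*_)
open import Data.Fin using (Fin)
open import Data.Product using (∃)
open import Data.Rational using (ℚ; _≤_)

open import Data.Bool using (Bool; true; false; T; if_then_else_)
open import Data.Bool.Properties using (T-≡)
import Data.Bool as Bool
open import Data.Fin using (zero; suc; _≟_; punchIn; punchOut)
open import Data.Fin.Properties using (any?; punchIn-injective; punchInᵢ≢i; punchIn-punchOut)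
open import Data.Fin.Subset using (Subset; _∈_; _⊂_; ∣_∣; _∪_; ⁅_⁆)
  renaming (⊥ to ∅)
open import Data.Fin.Subset.Properties
  using (_∈?_; ∉⊥; x∈⁅x⁆; x∈⁅y⁆⇒x≡y; x∈p∪q⁻; p⊆p∪q; q⊆p∪q; p⊂q⇒∣p∣<∣q∣)
import Data.Integer as ℤ
import Data.Integer.Properties as ℤ
open import Data.List using (List; []; _∷_; allFin; foldr; map; length; filter)
import Data.List.Membership.Propositional as List
open import Data.List.Membership.Propositional.Properties using (∈-filter⁺; ∈-allFin)
open import Data.List.Relation.Unary.Any as Any using (Any; here; there)
import Data.Nat as ℕ
import Data.Nat.Properties as ℕ
open import Data.Product using (_×_; _,_; proj₁; proj₂)
open import Data.Rational using (0ℚ; 1ℚ; _+_; _<_; *<*)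
open import Data.Rational.Properties hiding (_≟_)
open import Data.Rational.Unnormalised as ℚᵘ using (mkℚᵘ)
import Data.Rational.Unnormalised.Properties as ℚᵘ
open import Data.Sum using (_⊎_; inj₁; inj₂; map₂)
open import Function using (_∘_; id)
open import Function.Bundles using (Equivalence)
open import Level using (0ℓ)
open import Relation.Binary.PropositionalEquality
  using (_≡_; _≢_; refl; cong; cong₂; subst; trans; ≢-sym)
  renaming (sym to ≡-sym)
open import Relation.Nullary using (¬_; yes; no; does; contradiction; _×-dec_; _⊎-dec_)
open import Relation.Nullary.Decidable using (T?; toSum)
open import Relation.Unary using (Pred; Decidable)
open import Relation.Unary.Properties using (U?; ∁?)

private variable
  n m t : ℕ

-- Naturals as rationals, and finite rational sums.

ℕtoℚ-mono-≤ : ∀ {a b} → a ℕ.≤ b → ℕtoℚ a ≤ ℕtoℚ b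
-- `ℕtoℚ` normalises its fraction, which does not compute on a variable, so the comparison passes
-- through unnormalised fractions; the `0` encodes denominator 1.
ℕtoℚ-mono-≤ {a} {b} a≤b = toℚᵘ-cancel-≤ (begin
  _                    ≃⟨ toℚᵘ-fromℚᵘ (mkℚᵘ (ℤ.+ a) 0) ⟩
  mkℚᵘ (ℤ.+ a) 0       ≤⟨ ℚᵘ.*≤* (ℤ.*-monoʳ-≤-nonNeg (ℤ.+ 1) (ℤ.+≤+ a≤b)) ⟩
  mkℚᵘ (ℤ.+ b) 0       ≃⟨ toℚᵘ-fromℚᵘ (mkℚᵘ (ℤ.+ b) 0) ⟨
  _                    ∎)
  where open ℚᵘ.≤-Reasoning

ℕtoℚ-homo-+ : ∀ a b → ℕtoℚ (a ℕ.+ b) ≡ ℕtoℚ a + ℕtoℚ b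
ℕtoℚ-homo-+ a b = toℚᵘ-injective (begin
  _                                   ≈⟨ toℚᵘ-fromℚᵘ (mkℚᵘ (ℤ.+ (a ℕ.+ b)) 0) ⟩
  mkℚᵘ (ℤ.+ (a ℕ.+ b)) 0              ≈⟨ ℚᵘ.*≡* (cong (ℤ._* ℤ.+ 1)
                                           (≡-sym (cong₂ ℤ._+_ (ℤ.*-identityʳ (ℤ.+ a)) (ℤ.*-identityʳ (ℤ.+ b))))) ⟩
  mkℚᵘ (ℤ.+ a) 0 ℚᵘ.+ mkℚᵘ (ℤ.+ b) 0  ≈⟨ ℚᵘ.+-cong (toℚᵘ-fromℚᵘ (mkℚᵘ (ℤ.+ a) 0))
                                                    (toℚᵘ-fromℚᵘ (mkℚᵘ (ℤ.+ b) 0)) ⟨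
  _                                   ≈⟨ toℚᵘ-homo-+ (ℕtoℚ a) (ℕtoℚ b) ⟨
  _                                   ∎)
  where open import Relation.Binary.Reasoning.Setoid ℚᵘ.≃-setoid

0≤ℕtoℚ : ∀ a → 0ℚ ≤ ℕtoℚ a
0≤ℕtoℚ a = ℕtoℚ-mono-≤ {0} {a} ℕ.z≤n

sumℚ-mono-+ : {f g h : Fin n → ℚ} → (∀ i → f i ≤ g i + h i) → sumℚ f ≤ sumℚ g + sumℚ h
sumℚ-mono-+ {n} {f} {g} {h} f≤g+h = go (allFin n)
  where
  open import Algebra.Bundles using (CommutativeMonoid)
  open import Algebra.Properties.CommutativeSemigroup
    (CommutativeMonoid.commutativeSemigroup +-0-commutativeMonoid) using (interchange)

  go : ∀ is → foldr _+_ 0ℚ (map f is) ≤ foldr _+_ 0ℚ (map g is) + foldr _+_ 0ℚ (map h is)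
  go []       = ≤-refl
  go (i ∷ is) = ≤-trans (+-mono-≤ (f≤g+h i) (go is)) (≤-reflexive (interchange (g i) (h i) _ _))

sumℚ-mono : {f g : Fin n → ℚ} → (∀ i → f i ≤ g i) → sumℚ f ≤ sumℚ g
sumℚ-mono {n} {f} {g} f≤g = go (allFin n)
  where
  go : ∀ is → foldr _+_ 0ℚ (map f is) ≤ foldr _+_ 0ℚ (map g is)
  go []       = ≤-refl
  go (i ∷ is) = +-mono-≤ (f≤g i) (go is)

sumℚ-nonPos : {f : Fin n → ℚ} → (∀ i → f i ≤ 0ℚ) → sumℚ f ≤ 0ℚ
sumℚ-nonPos {n} {f} f≤0 = go (allFin n)
  where
  go : ∀ is → foldr _+_ 0ℚ (map f is) ≤ 0ℚ
  go []       = ≤-refl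
  go (i ∷ is) = +-mono-≤ (f≤0 i) (go is)

sumℚ-positive : {f : Fin n → ℚ} → 0ℚ < sumℚ f → ∃ λ i → 0ℚ < f i
sumℚ-positive {f = f} 0<∑f with any? (λ i → 0ℚ <? f i)
... | yes ∃i = ∃i
... | no  ∄i = contradiction (<-≤-trans 0<∑f (sumℚ-nonPos λ i → ≮⇒≥ λ 0<fi → ∄i (i , 0<fi))) (<-irrefl refl)

-- Weights of decidable vertex sets.

restrict : {P : Pred (Fin n) 0ℓ} → (Fin n → ℚ) → Decidable P → Fin n → ℚ
restrict w P? x = if does (P? x) then w x else 0ℚ

weight : {P : Pred (Fin n) 0ℓ} → (Fin n → ℚ) → Decidable P → ℚ
weight w P? = sumℚ (restrict w P?)

module Weight (w : Fin n → ℚ) (0≤w : ∀ x → 0ℚ ≤ w x) where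

  private variable
    P Q R : Pred (Fin n) 0ℓ

  restrict-nonNeg : (P? : Decidable P) → ∀ x → 0ℚ ≤ restrict w P? x
  restrict-nonNeg P? x with P? x
  ... | yes _ = 0≤w x
  ... | no  _ = ≤-refl

  restrict-≤ : (P? : Decidable P) → ∀ x → restrict w P? x ≤ w x
  restrict-≤ P? x with P? x
  ... | yes _ = ≤-refl
  ... | no  _ = 0≤w x

  restrict-positive : (P? : Decidable P) → ∀ {x} → 0ℚ < restrict w P? x → P x × 0ℚ < w x
  restrict-positive P? {x} 0<r with P? x
  ... | yes Px = Px , 0<r
  ... | no  _  = contradiction 0<r (<-irrefl refl)

  restrict-⊎ : (P? : Decidable P) (Q? : Decidable Q) (R? : Decidable R) → ∀ {x} →
               (P x → Q x ⊎ R x) → restrict w P? x ≤ restrict w Q? x + restrict w R? x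
  restrict-⊎ P? Q? R? {x} cover with P? x
  ... | no  _  = +-mono-≤ (restrict-nonNeg Q? x) (restrict-nonNeg R? x)
  ... | yes Px with Q? x | R? x | cover Px
  ...   | yes _ | yes _ | _ = ≤-trans (≤-reflexive (≡-sym (+-identityʳ (w x)))) (+-monoʳ-≤ (w x) (0≤w x))
  ...   | yes _ | no _  | _ = ≤-reflexive (≡-sym (+-identityʳ (w x)))
  ...   | no _  | yes _ | _ = ≤-reflexive (≡-sym (+-identityˡ (w x)))
  ...   | no ¬Qx | no _   | inj₁ Qx = contradiction Qx ¬Qx
  ...   | no _   | no ¬Rx | inj₂ Rx = contradiction Rx ¬Rx

  -- The first summand uses the weight that vanishes on `R`, so the overlap of `Q` and `R` is
  -- counted once. In the packing, the ball of a new centre is bounded only in such a reduced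
  -- weight.
  restrict-∁ : (P? : Decidable P) (Q? : Decidable Q) (R? : Decidable R) → ∀ {x} → (P x → Q x ⊎ R x) →
               restrict w P? x ≤ restrict (restrict w (∁? R?)) Q? x + restrict w R? x
  restrict-∁ P? Q? R? {x} cover with P? x | Q? x | R? x
  ... | yes _  | yes _  | yes _  = ≤-reflexive (≡-sym (+-identityˡ (w x)))
  ... | yes _  | yes _  | no _   = ≤-reflexive (≡-sym (+-identityʳ (w x)))
  ... | yes _  | no _   | yes _  = ≤-reflexive (≡-sym (+-identityˡ (w x)))
  ... | no _   | yes _  | yes _  = ≤-trans (0≤w x) (≤-reflexive (≡-sym (+-identityˡ (w x))))
  ... | no _   | yes _  | no _   = ≤-trans (0≤w x) (≤-reflexive (≡-sym (+-identityʳ (w x))))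
  ... | no _   | no _   | yes _  = ≤-trans (0≤w x) (≤-reflexive (≡-sym (+-identityˡ (w x))))
  ... | no _   | no _   | no _   = ≤-refl
  ... | yes Px | no ¬Qx | no ¬Rx with cover Px
  ...   | inj₁ Qx = contradiction Qx ¬Qx
  ...   | inj₂ Rx = contradiction Rx ¬Rx

  weight-⊎ : (P? : Decidable P) (Q? : Decidable Q) (R? : Decidable R) →
             (∀ x → P x → Q x ⊎ R x) → weight w P? ≤ weight w Q? + weight w R?
  weight-⊎ P? Q? R? cover = sumℚ-mono-+ λ x → restrict-⊎ P? Q? R? (cover x)

  weight-mono : (P? : Decidable P) (Q? : Decidable Q) → (∀ x → P x → Q x) → weight w P? ≤ weight w Q?
  weight-mono P? Q? P⊆Q = sumℚ-mono pointwise
    where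
    pointwise : ∀ x → restrict w P? x ≤ restrict w Q? x
    pointwise x with P? x
    ... | no  _  = restrict-nonNeg Q? x
    ... | yes Px with Q? x
    ...   | yes _  = ≤-refl
    ...   | no ¬Qx = contradiction (P⊆Q x Px) ¬Qx

  weight-empty : (P? : Decidable P) → (∀ x → ¬ P x) → weight w P? ≤ 0ℚ
  weight-empty P? empty = sumℚ-nonPos pointwise
    where
    pointwise : ∀ x → restrict w P? x ≤ 0ℚ
    pointwise x with P? x
    ... | yes Px = contradiction Px (empty x)
    ... | no  _  = ≤-refl

  -- Union bound. The length is bounded by `l` rather than equal to it, so that a bound on the red
  -- degree applies directly.
  weight-⋃ : {I : Set} {P : I → Pred (Fin n) 0ℓ} (P? : ∀ i → Decidable (P i)) {b l : ℕ} →
             (∀ i → weight w (P? i) ≤ ℕtoℚ b) → (is : List I) → length is ℕ.≤ l →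
             weight w (λ x → Any.any? (λ i → P? i x) is) ≤ ℕtoℚ (l * b)
  weight-⋃ P? {b} {l} bound [] _ = ≤-trans (weight-empty (λ x → Any.any? (λ i → P? i x) []) λ _ ()) (0≤ℕtoℚ (l * b))
  weight-⋃ P? {b} {ℕ.suc l} bound (i ∷ is) (ℕ.s≤s len) = begin
    weight w (λ x → Any.any? (λ i → P? i x) (i ∷ is))
      ≤⟨ weight-⊎ (λ x → Any.any? (λ i → P? i x) (i ∷ is)) (P? i) (λ x → Any.any? (λ i → P? i x) is)
           (λ { x (here Pix) → inj₁ Pix ; x (there any) → inj₂ any }) ⟩
    weight w (P? i) + weight w (λ x → Any.any? (λ i → P? i x) is)
      ≤⟨ +-mono-≤ (bound i) (weight-⋃ P? bound is len) ⟩
    ℕtoℚ b + ℕtoℚ (l * b)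
      ≡⟨ ℕtoℚ-homo-+ b (l * b) ⟨
    ℕtoℚ (ℕ.suc l * b) ∎
    where open ≤-Reasoning

-- Trigraphs as quotients of the original graph.

data Describes : Colour → Bool → Set where
  none  : Describes none false
  black : Describes black true
  red   : ∀ {b} → Describes red b

-- A merged colour is black or absent only if both colours are, and red is compatible with either
-- adjacency, so a pair described before the merge stays described.
merge-describesˡ : ∀ {c d b} → Describes c b → Describes (merge c d) b
merge-describesˡ {d = none}  none  = none
merge-describesˡ {d = black} none  = red
merge-describesˡ {d = red}   none  = red
merge-describesˡ {d = none}  black = red
merge-describesˡ {d = black} black = black
merge-describesˡ {d = red}   black = red
merge-describesˡ {d = none}  red   = red
merge-describesˡ {d = black} red   = red
merge-describesˡ {d = red}   red   = red

merge-describesʳ : ∀ {c d b} → Describes d b → Describes (merge c d) b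
merge-describesʳ {c = none}  none  = none
merge-describesʳ {c = black} none  = red
merge-describesʳ {c = red}   none  = red
merge-describesʳ {c = none}  black = red
merge-describesʳ {c = black} black = black
merge-describesʳ {c = red}   black = red
merge-describesʳ {c = none}  red   = red
merge-describesʳ {c = black} red   = red
merge-describesʳ {c = red}   red   = red

-- Ties a trigraph of the sequence to the original graph without recording the history of
-- contractions: the fibres of `π` are the parts.
IsQuotient : Graph n → Trigraph m → (Fin n → Fin m) → Set
IsQuotient G H π = ∀ x y → π x ≢ π y → Describes (H (π x) (π y)) (adj G x y)

toTrigraph-isQuotient : (G : Graph n) → IsQuotient G (toTrigraph G) id
toTrigraph-isQuotient G x y _ with adj G x y
... | true  = black
... | false = none

module _ {u v : Fin (ℕ.suc (ℕ.suc m))} (u≢v : u ≢ v) where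

  -- Tracks vertex names through `contract`: `v` goes to the new position of `u`, and the others are
  -- renumbered around the gap left by `v`.
  glue : Fin (ℕ.suc (ℕ.suc m)) → Fin (ℕ.suc m)
  glue c with v ≟ c
  ... | yes _   = punchOut (≢-sym u≢v)
  ... | no  v≢c = punchOut v≢c

  -- Inverts the renumbering. It drives the case split on merged vertices and also shows that a new
  -- part is covered by two old ones.
  punchIn-glue : ∀ c → c ≡ punchIn v (glue c) ⊎ (punchIn v (glue c) ≡ u × c ≡ v)
  punchIn-glue c with v ≟ c
  ... | yes v≡c = inj₂ (punchIn-punchOut (≢-sym u≢v) , ≡-sym v≡c)
  ... | no  v≢c = inj₁ (≡-sym (punchIn-punchOut v≢c))

  contract-isQuotient : {G : Graph n} {H : Trigraph (ℕ.suc (ℕ.suc m))} {π : Fin n → Fin (ℕ.suc (ℕ.suc m))} →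
                        IsQuotient G H π → IsQuotient G (contract H u v) (glue ∘ π)
  contract-isQuotient {G = G} {H} {π} quotient x y a≢b =
    go (glue (π x)) (glue (π y)) a≢b (punchIn-glue (π x)) (punchIn-glue (π y))
    where
    -- `contract` reads the colours from `u` and `v` outwards even when the merged vertex is the
    -- second argument, so there the pair is swapped, using the symmetry of `G`.
    flipped : π x ≢ π y → Describes (H (π y) (π x)) (adj G x y)
    flipped πx≢πy = subst (Describes _) (sym G y x) (quotient y x (≢-sym πx≢πy))

    -- The new names become variables so that the case split can follow the one in `contract`.
    go : ∀ a b → a ≢ b →
         π x ≡ punchIn v a ⊎ (punchIn v a ≡ u × π x ≡ v) →
         π y ≡ punchIn v b ⊎ (punchIn v b ≡ u × π y ≡ v) →
         Describes (contract H u v a b) (adj G x y)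
    go a b a≢b πx πy with punchIn v a | punchIn v b | punchInᵢ≢i v a | punchInᵢ≢i v b | a≢b ∘ punchIn-injective v a b
    ... | a' | b' | a'≢v | b'≢v | a'≢b' with a' ≟ u | b' ≟ u | πx | πy
    ... | yes refl | yes refl | _ | _ = contradiction refl a'≢b'
    ... | yes refl | no _ | inj₁ refl | inj₁ refl = merge-describesˡ (quotient x y a'≢b')
    ... | yes refl | no _ | inj₂ (_ , refl) | inj₁ refl = merge-describesʳ (quotient x y (≢-sym b'≢v))
    ... | yes refl | no b'≢u | _ | inj₂ (b'≡u , _) = contradiction b'≡u b'≢u
    ... | no _ | yes refl | inj₁ refl | inj₁ refl = merge-describesˡ (flipped a'≢b')
    ... | no _ | yes refl | inj₁ refl | inj₂ (_ , refl) = merge-describesʳ (flipped a'≢v)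
    ... | no a'≢u | yes refl | inj₂ (a'≡u , _) | _ = contradiction a'≡u a'≢u
    ... | no a'≢u | no b'≢u | inj₂ (a'≡u , _) | _ = contradiction a'≡u a'≢u
    ... | no a'≢u | no b'≢u | inj₁ _ | inj₂ (b'≡u , _) = contradiction b'≡u b'≢u
    ... | no _ | no _ | inj₁ refl | inj₁ refl = quotient x y a'≢b'

describes-none : ∀ {b} → Describes none b → ¬ T b
describes-none none ()

describes-black : ∀ {b} → Describes black b → T b
describes-black black = _

-- Closed neighbourhoods and balls of radius 2.

N : Graph n → Fin n → Pred (Fin n) 0ℓ
N G x y = y ≡ x ⊎ T (adj G x y)

-- Its `does` computes to the Boolean test in `closedNbhdSum`, so feasibility bounds
-- `weight w (N? G x)` by definition.
N? : (G : Graph n) (x : Fin n) → Decidable (N G x)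
N? G x y = (y ≟ x) ⊎-dec T? (adj G x y)

N-sym : (G : Graph n) → ∀ {x y} → N G x y → N G y x
N-sym G (inj₁ y≡x) = inj₁ (≡-sym y≡x)
N-sym G {x} {y} (inj₂ xy) = inj₂ (subst T (sym G x y) xy)

Ball : Graph n → Fin n → Pred (Fin n) 0ℓ
Ball G x y = ∃ λ z → N G x z × N G z y

Ball? : (G : Graph n) (x : Fin n) → Decidable (Ball G x)
Ball? G x y = any? λ z → N? G x z ×-dec N? G z y

Ball-refl : (G : Graph n) → ∀ x → Ball G x x
Ball-refl G x = x , inj₁ refl , inj₁ refl

Ball-sym : (G : Graph n) → ∀ {x y} → Ball G x y → Ball G y x
Ball-sym G (z , xz , zy) = z , N-sym G zy , N-sym G xz

Dist≤2⇒Ball : (G : Graph n) → ∀ {x y} → Dist≤2 G x y → Ball G x y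
Dist≤2⇒Ball G {x} (inj₁ xy)            = x , inj₁ refl , inj₂ (Equivalence.from T-≡ xy)
Dist≤2⇒Ball G     (inj₂ (z , xz , zy)) = z , inj₂ (Equivalence.from T-≡ xz) , inj₂ (Equivalence.from T-≡ zy)

-- The list whose length is `redDegree H a` by definition.
redNbrs : Trigraph m → Fin m → List (Fin m)
redNbrs H a = filter (λ b → isRed (H a b) Bool.≟ true) (allFin _)

-- An edge of `G` between two parts rules out an absent edge of `H`. A red edge keeps `y` near the
-- part of `x`, and a black edge makes `y` a neighbour of that entire part.
quotient-N : {G : Graph n} {H : Trigraph m} {π : Fin n → Fin m} → IsQuotient G H π → ∀ {x y} → N G x y →
             π y List.∈ (π x ∷ redNbrs H (π x)) ⊎ (∀ x' → π x' ≡ π x → N G x' y)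
quotient-N _ (inj₁ refl) = inj₁ (here refl)
quotient-N {G = G} {H} {π} quotient {x} {y} (inj₂ xy) with π x ≟ π y
... | yes πx≡πy = inj₁ (here (≡-sym πx≡πy))
... | no  πx≢πy with H (π x) (π y) in eq
...   | none  = contradiction xy (describes-none (subst (λ c → Describes c _) eq (quotient x y πx≢πy)))
...   | red   = inj₁ (there (∈-filter⁺ (λ b → isRed (H (π x) b) Bool.≟ true) (∈-allFin (π y)) (cong isRed eq)))
...   | black = inj₂ λ x' πx'≡πx → inj₂ (describes-black
        (subst (λ c → Describes c _) (trans (cong (λ a → H a (π y)) πx'≡πx) eq)
          (quotient x' y (πx≢πy ∘ trans (≡-sym πx'≡πx)))))

-- The first heavy part and a ball of bounded weight.

DSeq⇒redDegree≤ : ∀ {H} → DSeq t m H → RedDegreeAtMost t H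
DSeq⇒redDegree≤ (done _ red≤)         = red≤
DSeq⇒redDegree≤ (step _ red≤ _ _ _ _) = red≤

-- A part and its red neighbours are at most `t + 1` parts of weight at most 2; the last 1 pays for
-- one closed neighbourhood holding all black neighbours.
nbhdBound : ℕ → ℕ
nbhdBound t = ℕ.suc t * 2 ℕ.+ 1

ballBound : ℕ → ℕ
ballBound t = ℕ.suc t * nbhdBound t

module _ {G : Graph n} {w : Fin n → ℚ} (feasible : Feasible G w) where

  open Weight w (proj₁ ∘ feasible)

  Part? : (π : Fin n → Fin m) (a : Fin m) → Decidable (λ x → π x ≡ a)
  Part? π a x = π x ≟ a

  weight-N≤1 : ∀ x → weight w (N? G x) ≤ 1ℚ
  weight-N≤1 x = proj₂ (proj₂ (feasible x))

  module _ {H : Trigraph m} {π : Fin n → Fin m} (quotient : IsQuotient G H π)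
           (redDegree≤t : RedDegreeAtMost t H)
           (part≤2 : ∀ a → weight w (Part? π a) ≤ ℕtoℚ 2) where

    NPart : Fin m → Pred (Fin n) 0ℓ
    NPart a y = ∃ λ x → π x ≡ a × N G x y

    NPart? : (a : Fin m) → Decidable (NPart a)
    NPart? a y = any? λ x → (π x ≟ a) ×-dec N? G x y

    weight-NPart : ∀ a → weight w (NPart? a) ≤ ℕtoℚ (nbhdBound t)
    weight-NPart a with any? (λ x → π x ≟ a)
    ... | no  ∄x = ≤-trans (weight-empty (NPart? a) λ { y (x , πx≡a , _) → ∄x (x , πx≡a) })
                           (0≤ℕtoℚ (nbhdBound t))
    ... | yes (u , refl) = begin
      weight w (NPart? (π u))
        ≤⟨ weight-⊎ (NPart? (π u)) near? (N? G u) cover ⟩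
      weight w near? + weight w (N? G u)
        ≤⟨ +-mono-≤ (weight-⋃ (Part? π) {b = 2} part≤2 (π u ∷ redNbrs H (π u)) (ℕ.s≤s (redDegree≤t (π u))))
                    (weight-N≤1 u) ⟩
      ℕtoℚ (ℕ.suc t * 2) + ℕtoℚ 1
        ≡⟨ ℕtoℚ-homo-+ (ℕ.suc t * 2) 1 ⟨
      ℕtoℚ (nbhdBound t) ∎
      where
      open ≤-Reasoning
      near? : Decidable (λ y → π y List.∈ (π u ∷ redNbrs H (π u)))
      near? y = Any.any? (λ b → Part? π b y) (π u ∷ redNbrs H (π u))

      cover : ∀ y → NPart (π u) y → π y List.∈ (π u ∷ redNbrs H (π u)) ⊎ N G u y
      cover y (x , πx≡πu , xy) with quotient-N {G = G} {H} quotient xy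
      ... | inj₁ near = inj₁ (subst (λ a → π y List.∈ (a ∷ redNbrs H a)) πx≡πu near)
      -- Across a black edge, a neighbour of `x` is also a neighbour of the representative `u`.
      ... | inj₂ homogeneous = inj₂ (homogeneous u (≡-sym πx≡πu))

    heavy-no-black : ∀ {v} → 1ℚ < weight w (Part? π (π v)) → ∀ {z} → N G v z →
                     π z List.∈ (π v ∷ redNbrs H (π v))
    heavy-no-black {v} heavy {z} vz with quotient-N {G = G} {H} quotient vz
    ... | inj₁ near = near
    ... | inj₂ homogeneous = contradiction (<-≤-trans heavy part≤1) (<-irrefl refl)
      where
      part≤1 : weight w (Part? π (π v)) ≤ 1ℚ
      part≤1 = ≤-trans (weight-mono (Part? π (π v)) (N? G z) λ x πx≡πv → N-sym G (homogeneous x πx≡πv))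
                       (weight-N≤1 z)

    -- The first step from `v` ends in one of at most `t + 1` parts, and the second stays in the
    -- closed neighbourhood of that part.
    heavy-ball : ∀ {v} → 1ℚ < weight w (Part? π (π v)) → weight w (Ball? G v) ≤ ℕtoℚ (ballBound t)
    heavy-ball {v} heavy = ≤-trans
      (weight-mono (Ball? G v) (λ y → Any.any? (λ a → NPart? a y) _)
        λ { y (z , vz , zy) → Any.map (λ πz≡a → z , πz≡a , zy) (heavy-no-black {v} heavy {z} vz) })
      (weight-⋃ NPart? {b = nbhdBound t} weight-NPart (π v ∷ redNbrs H (π v)) (ℕ.s≤s (redDegree≤t (π v))))

    heavy-centre : ∀ {a} → 1ℚ < weight w (Part? π a) →
                   ∃ λ v → 0ℚ < w v × weight w (Ball? G v) ≤ ℕtoℚ (ballBound t)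
    -- The explicit term proves `0ℚ < 1ℚ`, so a heavy part contains a vertex of positive weight.
    heavy-centre {a} heavy with sumℚ-positive (<-trans (*<* (ℤ.+<+ (ℕ.s≤s ℕ.z≤n))) heavy)
    ... | v , 0<rv with restrict-positive (Part? π a) {v} 0<rv
    ...   | refl , 0<wv = v , 0<wv , heavy-ball {v} heavy

  -- Handles a sequence that ends without a heavy part: the total weight, hence that of any ball, is
  -- then at most 1.
  light-centre : 0ℚ < sumℚ w → sumℚ w ≤ 1ℚ → ∃ λ v → 0ℚ < w v × weight w (Ball? G v) ≤ ℕtoℚ (ballBound t)
  light-centre {t} 0<W W≤1 with sumℚ-positive 0<W
  ... | v , 0<wv = v , 0<wv , ≤-trans (sumℚ-mono (restrict-≤ (Ball? G v)))
                                (≤-trans W≤1 (ℕtoℚ-mono-≤ {1} {ballBound t} (ℕ.s≤s ℕ.z≤n)))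

  -- Induction along the sequence with the invariant that no part is heavy, stopping at the first
  -- contraction that breaks it.
  centre : ∀ {H π} → 0ℚ < sumℚ w → DSeq t m H → IsQuotient G H π →
           (∀ a → weight w (Part? π a) ≤ 1ℚ) →
           ∃ λ v → 0ℚ < w v × weight w (Ball? G v) ≤ ℕtoℚ (ballBound t)
  centre {t = t} {π = π} 0<W (done _ _) _ part≤1 = light-centre {t} 0<W
    (≤-trans (weight-mono U? (Part? π zero) λ x _ → unique (π x)) (part≤1 zero))
    where
    unique : (a : Fin 1) → a ≡ zero
    unique zero = refl
  centre {t = t} {π = π} 0<W (step H _ u v u≢v seq) quotient part≤1
    with any? (λ a → 1ℚ <? weight w (Part? (glue u≢v ∘ π) a))
  ... | no  ∄heavy = centre {H = contract H u v} 0<W seq quotient' λ a → ≮⇒≥ λ heavy → ∄heavy (a , heavy)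
    where quotient' = contract-isQuotient u≢v {G = G} {H} {π} quotient
  ... | yes (a , heavy) =
    -- The heavy part lives in the contracted trigraph, so its red degree bound is read off the
    -- remaining sequence.
    heavy-centre {H = contract H u v} (contract-isQuotient u≢v {G = G} {H} {π} quotient) (DSeq⇒redDegree≤ seq) glued≤2 heavy
    where
    glued≤2 : ∀ b → weight w (Part? (glue u≢v ∘ π) b) ≤ ℕtoℚ 2
    glued≤2 b = ≤-trans
      (weight-⊎ (Part? (glue u≢v ∘ π) b) (Part? π (punchIn v b)) (Part? π v)
        λ { x refl → map₂ proj₂ (punchIn-glue u≢v (π x)) })
      (+-mono-≤ (part≤1 (punchIn v b)) (part≤1 v))

TwinWidth⇒centre : {G : Graph n} {w : Fin n → ℚ} → TwinWidthAtMost t G → Feasible G w → 0ℚ < sumℚ w →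
                   ∃ λ v → 0ℚ < w v × weight w (Ball? G v) ≤ ℕtoℚ (ballBound t)
TwinWidth⇒centre {ℕ.zero} _ _ 0<0 = contradiction 0<0 (<-irrefl refl)
TwinWidth⇒centre {ℕ.suc n} {G = G} {w} seq feasible 0<W =
  centre {G = G} feasible {H = toTrigraph G} {id} 0<W seq (toTrigraph-isQuotient G) λ x →
    -- The initial parts are singletons, each inside its own closed neighbourhood.
    ≤-trans (weight-mono (λ y → y ≟ x) (N? G x) λ _ → inj₁) (weight-N≤1 {G = G} feasible x)
  where open Weight w (proj₁ ∘ feasible)

-- Greedy packing: covered weight is set to zero and the search restarts.

restrict-feasible : {G : Graph n} {w : Fin n → ℚ} {P : Pred (Fin n) 0ℓ} (P? : Decidable P) →
                    Feasible G w → Feasible G (restrict w P?)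
restrict-feasible {G = G} {w} P? feasible x =
  restrict-nonNeg P? x , ≤-trans (restrict-≤ P? x) (proj₁ (proj₂ (feasible x))) ,
  ≤-trans (sumℚ-mono pointwise) (proj₂ (proj₂ (feasible x)))
  where
  open Weight w (proj₁ ∘ feasible)

  pointwise : ∀ y → restrict (restrict w P?) (N? G x) y ≤ restrict w (N? G x) y
  pointwise y with does (N? G x y)
  ... | true  = restrict-≤ P? y
  ... | false = ≤-refl

module _ {G : Graph n} {w : Fin n → ℚ} (tww : TwinWidthAtMost t G) (feasible : Feasible G w) where

  open Weight w (proj₁ ∘ feasible)

  Covered : Subset n → Pred (Fin n) 0ℓ
  Covered S y = ∃ λ s → s ∈ S × Ball G s y

  Covered? : (S : Subset n) → Decidable (Covered S)
  Covered? S y = any? λ s → (s ∈? S) ×-dec Ball? G s y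

  -- The inequality `j ≤ ∣S∣` lets a strict inclusion advance the count, with no need to compute the
  -- size of a union.
  Packing : ℕ → Subset n → Set
  Packing j S = Independent₂ G S × j ℕ.≤ ∣ S ∣ × weight w (Covered? S) ≤ ℕtoℚ (j * ballBound t)

  -- If no weight is left outside the balls, they account for the total; otherwise the remaining
  -- weight supplies a new centre.
  extend : ∀ {j S} → Packing j S → sumℚ w ≤ ℕtoℚ (j * ballBound t) ⊎ ∃ (Packing (ℕ.suc j))
  extend {j} {S} (indep , j≤∣S∣ , covered≤) = result
    where
    open ≤-Reasoning

    far : Fin n → ℚ
    far = restrict w (∁? (Covered? S))

    result : sumℚ w ≤ ℕtoℚ (j * ballBound t) ⊎ ∃ (Packing (ℕ.suc j))
    result with 0ℚ <? sumℚ far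
    ... | no ¬0<far = inj₁ (begin
      sumℚ w                              ≤⟨ weight-⊎ U? (Covered? S) (∁? (Covered? S)) (λ x _ → toSum (Covered? S x)) ⟩
      weight w (Covered? S) + sumℚ far    ≤⟨ +-mono-≤ covered≤ (≮⇒≥ ¬0<far) ⟩
      ℕtoℚ (j * ballBound t) + 0ℚ         ≡⟨ +-identityʳ _ ⟩
      ℕtoℚ (j * ballBound t)              ∎)
    ... | yes 0<far with TwinWidth⇒centre tww (restrict-feasible {G = G} (∁? (Covered? S)) feasible) 0<far
    ...   | v , 0<farv , ball≤ = inj₂ (S' , indep' , ℕ.≤-trans (ℕ.s≤s j≤∣S∣) (p⊂q⇒∣p∣<∣q∣ S⊂S') , covered'≤)
      where
      S' : Subset n
      S' = ⁅ v ⁆ ∪ S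

      -- Positive remaining weight puts `v` outside all earlier balls, which makes it new and at
      -- distance more than 2 from `S`.
      v-uncovered : ¬ Covered S v
      v-uncovered = proj₁ (restrict-positive (∁? (Covered? S)) {v} 0<farv)

      S⊂S' : S ⊂ S'
      S⊂S' = q⊆p∪q ⁅ v ⁆ S , v , p⊆p∪q S (x∈⁅x⁆ v) , λ v∈S → v-uncovered (v , v∈S , Ball-refl G v)

      indep' : Independent₂ G S'
      indep' x y x∈S' y∈S' x≢y xy with x∈p∪q⁻ ⁅ v ⁆ S x∈S' | x∈p∪q⁻ ⁅ v ⁆ S y∈S'
      ... | inj₂ x∈S | inj₂ y∈S = indep x y x∈S y∈S x≢y xy
      ... | inj₁ x∈v | inj₁ y∈v = x≢y (trans (x∈⁅y⁆⇒x≡y v x∈v) (≡-sym (x∈⁅y⁆⇒x≡y v y∈v)))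
      ... | inj₂ x∈S | inj₁ y∈v with refl ← x∈⁅y⁆⇒x≡y v y∈v = v-uncovered (x , x∈S , Dist≤2⇒Ball G xy)
      ... | inj₁ x∈v | inj₂ y∈S with refl ← x∈⁅y⁆⇒x≡y v x∈v =
        v-uncovered (y , y∈S , Ball-sym G (Dist≤2⇒Ball G xy))

      -- Vertices of the new ball that were already covered are charged to the second term only.
      covered-step : ∀ y → restrict w (Covered? S') y ≤ restrict far (Ball? G v) y + restrict w (Covered? S) y
      covered-step y = restrict-∁ (Covered? S') (Ball? G v) (Covered? S) λ
        { (s , s∈S' , sy) → case-∪ s s∈S' sy }
        where
        case-∪ : ∀ s → s ∈ S' → Ball G s y → Ball G v y ⊎ Covered S y
        case-∪ s s∈S' sy with x∈p∪q⁻ ⁅ v ⁆ S s∈S'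
        ... | inj₁ s∈v = inj₁ (subst (λ s → Ball G s y) (x∈⁅y⁆⇒x≡y v s∈v) sy)
        ... | inj₂ s∈S = inj₂ (s , s∈S , sy)

      covered'≤ : weight w (Covered? S') ≤ ℕtoℚ (ℕ.suc j * ballBound t)
      covered'≤ = begin
        weight w (Covered? S')                                 ≤⟨ sumℚ-mono-+ covered-step ⟩
        weight far (Ball? G v) + weight w (Covered? S)         ≤⟨ +-mono-≤ ball≤ covered≤ ⟩
        ℕtoℚ (ballBound t) + ℕtoℚ (j * ballBound t)            ≡⟨ ℕtoℚ-homo-+ (ballBound t) (j * ballBound t) ⟨
        ℕtoℚ (ℕ.suc j * ballBound t)                           ∎

  pack : ∀ {k} → (∀ S → Independent₂ G S → ∣ S ∣ ℕ.≤ k) → ∀ j →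
         sumℚ w ≤ ℕtoℚ (k * ballBound t) ⊎ ∃ (Packing j)
  pack ∣S∣≤k ℕ.zero = inj₂ (∅ , (λ _ _ x∈∅ → contradiction x∈∅ ∉⊥) , ℕ.z≤n ,
    weight-empty (Covered? ∅) λ { _ (_ , s∈∅ , _) → ∉⊥ s∈∅ })
  pack ∣S∣≤k (ℕ.suc j) with pack ∣S∣≤k j
  ... | inj₁ W≤ = inj₁ W≤
  ... | inj₂ (S , packing@(indep , j≤∣S∣ , _)) with extend packing
  ...   | inj₂ packing' = inj₂ packing'
  -- A packing that cannot be extended took `j` steps, and `j ≤ ∣S∣ ≤ k`.
  ...   | inj₁ W≤ = inj₁ (≤-trans W≤
      (ℕtoℚ-mono-≤ (ℕ.*-monoˡ-≤ (ballBound t) (ℕ.≤-trans j≤∣S∣ (∣S∣≤k S indep)))))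

theorem27 : (t : ℕ) → ∃ λ (c : ℕ) → ∀ {n} (G : Graph n) → TwinWidthAtMost t G →
    ∀ (k : ℕ) → IsAlpha₂ G k → ∀ (w : Fin n → ℚ) → Feasible G w → sumℚ w ≤ ℕtoℚ (c * k)
theorem27 t = ballBound t , bound
  where
  bound : ∀ {n} (G : Graph n) → TwinWidthAtMost t G →
    ∀ (k : ℕ) → IsAlpha₂ G k → ∀ (w : Fin n → ℚ) → Feasible G w → sumℚ w ≤ ℕtoℚ (ballBound t * k)
  -- Asking for `k + 1` steps forces the process to stop early, since no independent set has more
  -- than `k` elements.
  bound G tww k (_ , ∣S∣≤k) w feasible with pack tww feasible ∣S∣≤k (ℕ.suc k)
  ... | inj₁ W≤ = subst (λ b → sumℚ w ≤ ℕtoℚ b) (ℕ.*-comm k (ballBound t)) W≤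
  ... | inj₂ (S , indep , k<∣S∣ , _) = contradiction (∣S∣≤k S indep) (ℕ.<⇒≱ k<∣S∣)
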